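{- Let $\mathfrak A$ be a structure over a countable relational signature $\tau$ (possibly with constants) that is $\omega$-saturated and has the homomorphism lifting property. Then a first-order definable relation $R$ on $A$ is preserved by all $\omega$-polymorphisms of $\mathfrak A$ if and only if $R$ is pp-definable in $\mathfrak A$; that is, $\mathrm{Inv}(\mathrm{Pol}^\omega(\mathfrak A))\cap\langle\mathfrak A\rangle_{\mathrm{fo}}=\langle\mathfrak A\rangle_{\mathrm{pp}}$.
   Context: A pp-formula is built from atomic formulas (including equalities and $\bot$) using conjunction and existential quantification. $\langle\mathfrak A\rangle_{\mathrm{fo}}$ and $\langle\mathfrak A\rangle_{\mathrm{pp}}$ are the sets of relations on $A$ definable in $\mathfrak A$ without parameters by first-order, respectively pp-, formulas. For a cardinal $\kappa$, $\mathfrak A^\kappa$ is the direct product (a tuple of elements of $A^\kappa$ is in $R$ iff it is in $R$ coordinatewise; constants are interpreted coordinatewise); a $\kappa$-polymorphism is a homomorphism $\mathfrak A^\kappa\to\mathfrak A$, and $\mathrm{Pol}^\omega(\mathfrak A)$ is the set of all $\kappa$-polymorphisms with $\kappa\le\omega$. For a set $F$ of operations on $A$, $\mathrm{Inv}(F)$ is the set of relations on $A$ preserved coordinatewise by every $f\in F$ (an $m$-ary $R$ is preserved by $f:A^\kappa\to A$ if whenever $(a^\beta_1,\dots,a^\beta_m)\in R$ for all $\beta<\kappa$, then $(f(\langle a^\beta_1\rangle_\beta),\dots,f(\langle a^\beta_m\rangle_\beta))\in R$). $\mathfrak A$ is $\omega$-saturated if for every finite sequence of parameters from $A$, every set of first-order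 formulas in one free variable with these parameters that is consistent with the theory of $\mathfrak A$ expanded by the parameters is realised in $A$. $\mathfrak A$ has the homomorphism lifting property if for all $a_1,\dots,a_k\in A^\omega$ and $b_1,\dots,b_k\in A$ such that every pp-$(\tau\cup\{c_1,\dots,c_k\})$-sentence true in $(\mathfrak A^\omega;a_1,\dots,a_k)$ is true in $(\mathfrak A;b_1,\dots,b_k)$, there is a homomorphism $f:(\mathfrak A^\omega;a_1,\dots,a_k)\to(\mathfrak A;b_1,\dots,b_k)$ (i.e. a homomorphism $\mathfrak A^\omega\to\mathfrak A$ with $f(a_i)=b_i$). -}

module Defs where

open import Level using (Level; _⊔_) renaming (suc to lsuc)
open import Data.Empty.Polymorphic using () renaming (⊥ to Empty)
open import Data.Fin using (Fin; zero; suc)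
open import Data.List using (List; _∷_; map)
open import Data.List.Membership.Propositional using (_∈_)
open import Data.List.Relation.Unary.All using (All)
open import Data.Nat using (ℕ; suc; NonZero)
open import Data.Product using (∃; ∃-syntax; _×_; _,_)
open import Data.Sum using (_⊎_; [_,_])
open import Data.Vec as Vec using (Vec; []; _∷_; lookup)
open import Data.Vec.Relation.Binary.Pointwise.Inductive as Pw using (Pointwise)
open import Function using (_∘_; _⇔_; _↣_)
open import Relation.Binary using (Setoid)
open import Relation.Binary.PropositionalEquality using (_≡_)
open import Relation.Nullary using (¬_)
open import Relation.Unary using (Pred; _∪_)

private variable
  ℓ : Level
  n m : ℕ

record Signature : Set₁ where
  field
    Rel   : Set
    arity : Rel → ℕ
    Con   : Set

open Signature

Countable : Signature → Set
Countable τ = (Rel τ ↣ ℕ) × (Con τ ↣ ℕ)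

-- The signature τ ∪ {c₁,…,cₖ}.
_⊕_ : Signature → ℕ → Signature
τ ⊕ k = record { Rel = Rel τ ; arity = arity τ ; Con = Con τ ⊎ Fin k }

-- Sets are setoids: _≈_ plays the role of equality of elements, so that
-- equality in a power is coordinatewise without function extensionality.
record Structure (τ : Signature) (ℓ : Level) : Set (lsuc ℓ) where
  field
    domain : Setoid ℓ ℓ
  open Setoid domain public
  field
    nonempty : Carrier
    rel      : (r : Rel τ) → Pred (Vec Carrier (arity τ r)) ℓ
    rel-resp : ∀ r {xs ys} → Pointwise _≈_ xs ys → rel r xs → rel r ys
    con      : Con τ → Carrier

open Structure using (Carrier)

-- The expansion (𝔄; a₁,…,aₖ).
_⟪_⟫ : ∀ {τ k} (A : Structure τ ℓ) → Vec (Carrier A) k → Structure (τ ⊕ k) ℓ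
A ⟪ a ⟫ = record
  { domain   = domain
  ; nonempty = nonempty
  ; rel      = rel
  ; rel-resp = rel-resp
  ; con      = [ con , lookup a ]
  } where open Structure A

-- A tuple of elements of the power is a vector of functions, evaluated here
-- at one coordinate.
infixl 9 _at_
_at_ : ∀ {a} {I : Set} {X : Set a} → Vec (I → X) n → I → Vec X n
xs at i = Vec.map (λ x → x i) xs

_^_ : ∀ {τ} → Structure τ ℓ → Set → Structure τ ℓ
A ^ I = record
  { domain   = record
    { Carrier       = I → Carrier A
    ; _≈_           = λ x y → ∀ i → x i ≈ y i
    ; isEquivalence = record
      { refl  = λ _ → refl
      ; sym   = λ p i → sym (p i)
      ; trans = λ p q i → trans (p i) (q i)
      }
    }
  ; nonempty = λ _ → nonempty
  ; rel      = λ r xs → ∀ i → rel r (xs at i)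
  ; rel-resp = λ r p h i → rel-resp r (Pw.map⁺ (λ q → q i) p) (h i)
  ; con      = λ c _ → con c
  } where open Structure A hiding (Carrier)

record IsHomomorphism {τ} (A B : Structure τ ℓ) (f : Carrier A → Carrier B) : Set ℓ where
  private
    module A = Structure A
    module B = Structure B
  field
    cong     : ∀ {x y} → x A.≈ y → f x B.≈ f y
    rel-pres : ∀ r {xs} → A.rel r xs → B.rel r (Vec.map f xs)
    con-pres : ∀ c → f (A.con c) B.≈ B.con c

module _ (τ : Signature) where

  data Term (n : ℕ) : Set where
    var : Fin n → Term n
    con : Con τ → Term n

  infix  8 _==_
  infixr 7 _∧_
  infixr 6 _∨_
  infixr 5 _⇒_

  -- Formulas in n free variables; a quantifier binds variable zero.
  data Formula (n : ℕ) : Set where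
    ⊥′          : Formula n
    rel         : (r : Rel τ) → Vec (Term n) (arity τ r) → Formula n
    _==_        : Term n → Term n → Formula n
    _∧_ _∨_ _⇒_ : Formula n → Formula n → Formula n
    ∀′ ∃′       : Formula (suc n) → Formula n

  Sentence : Set
  Sentence = Formula 0

module _ {τ : Signature} where

  data PP {n : ℕ} : Formula τ n → Set where
    ⊥′   : PP ⊥′
    rel  : ∀ r ts → PP (rel r ts)
    _==_ : ∀ s t → PP (s == t)
    _∧_  : ∀ {φ ψ} → PP φ → PP ψ → PP (φ ∧ ψ)
    ∃′   : ∀ {φ} → PP φ → PP (∃′ φ)

  module _ (A : Structure τ ℓ) where
    private module A = Structure A

    value : Vec A.Carrier n → Term τ n → A.Carrier
    value v (var i) = lookup v i
    value v (con c) = A.con c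

    Sat : Formula τ n → Vec A.Carrier n → Set ℓ
    Sat ⊥′         v = Empty
    Sat (rel r ts) v = A.rel r (Vec.map (value v) ts)
    Sat (s == t)   v = value v s A.≈ value v t
    Sat (φ ∧ ψ)    v = Sat φ v × Sat ψ v
    Sat (φ ∨ ψ)    v = Sat φ v ⊎ Sat ψ v
    Sat (φ ⇒ ψ)    v = Sat φ v → Sat ψ v
    Sat (∀′ φ)     v = ∀ x → Sat φ (x ∷ v)
    Sat (∃′ φ)     v = ∃[ x ] Sat φ (x ∷ v)

  _⊨_ : Structure τ ℓ → Sentence τ → Set ℓ
  A ⊨ φ = Sat A φ []

  Th : Structure τ ℓ → Pred (Sentence τ) ℓ
  Th A φ = A ⊨ φ

  Subst : ℕ → ℕ → Set
  Subst n m = Fin n → Term τ m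

  subᵗ : Subst n m → Term τ n → Term τ m
  subᵗ σ (var i) = σ i
  subᵗ σ (con c) = con c

  lift : Subst n m → Subst (suc n) (suc m)
  lift σ zero    = var zero
  lift σ (suc i) = subᵗ (var ∘ suc) (σ i)

  sub : Subst n m → Formula τ n → Formula τ m
  sub σ ⊥′         = ⊥′
  sub σ (rel r ts) = rel r (Vec.map (subᵗ σ) ts)
  sub σ (s == t)   = subᵗ σ s == subᵗ σ t
  sub σ (φ ∧ ψ)    = sub σ φ ∧ sub σ ψ
  sub σ (φ ∨ ψ)    = sub σ φ ∨ sub σ ψ
  sub σ (φ ⇒ ψ)    = sub σ φ ⇒ sub σ ψ
  sub σ (∀′ φ)     = ∀′ (sub (lift σ) φ)
  sub σ (∃′ φ)     = ∃′ (sub (lift σ) φ)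

  weaken : Formula τ n → Formula τ (suc n)
  weaken = sub (var ∘ suc)

  instantiate : Term τ n → Subst (suc n) n
  instantiate t zero    = t
  instantiate t (suc i) = var i

  _[_] : Formula τ (suc n) → Term τ n → Formula τ n
  φ [ t ] = sub (instantiate t) φ

  -- Classical natural deduction with equality.
  infix 4 _⊢_
  data _⊢_ {n : ℕ} (Γ : List (Formula τ n)) : Formula τ n → Set where
    ax      : ∀ {φ} → φ ∈ Γ → Γ ⊢ φ
    raa     : ∀ {φ} → (φ ⇒ ⊥′) ∷ Γ ⊢ ⊥′ → Γ ⊢ φ
    ∧-intro : ∀ {φ ψ} → Γ ⊢ φ → Γ ⊢ ψ → Γ ⊢ φ ∧ ψ
    ∧-elimˡ : ∀ {φ ψ} → Γ ⊢ φ ∧ ψ → Γ ⊢ φ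
    ∧-elimʳ : ∀ {φ ψ} → Γ ⊢ φ ∧ ψ → Γ ⊢ ψ
    ∨-introˡ : ∀ {φ ψ} → Γ ⊢ φ → Γ ⊢ φ ∨ ψ
    ∨-introʳ : ∀ {φ ψ} → Γ ⊢ ψ → Γ ⊢ φ ∨ ψ
    ∨-elim  : ∀ {φ ψ χ} → Γ ⊢ φ ∨ ψ → φ ∷ Γ ⊢ χ → ψ ∷ Γ ⊢ χ → Γ ⊢ χ
    ⇒-intro : ∀ {φ ψ} → φ ∷ Γ ⊢ ψ → Γ ⊢ φ ⇒ ψ
    ⇒-elim  : ∀ {φ ψ} → Γ ⊢ φ ⇒ ψ → Γ ⊢ φ → Γ ⊢ ψ
    ∀-intro : ∀ {φ} → map weaken Γ ⊢ φ → Γ ⊢ ∀′ φ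
    ∀-elim  : ∀ {φ} → Γ ⊢ ∀′ φ → ∀ t → Γ ⊢ φ [ t ]
    ∃-intro : ∀ {φ} t → Γ ⊢ φ [ t ] → Γ ⊢ ∃′ φ
    ∃-elim  : ∀ {φ ψ} → Γ ⊢ ∃′ φ → φ ∷ map weaken Γ ⊢ weaken ψ → Γ ⊢ ψ
    ==-refl : ∀ t → Γ ⊢ t == t
    ==-subst : ∀ φ {s t} → Γ ⊢ s == t → Γ ⊢ φ [ s ] → Γ ⊢ φ [ t ]

  Consistent : Pred (Formula τ n) ℓ → Set ℓ
  Consistent T = ¬ (∃[ Γ ] All T Γ × (Γ ⊢ ⊥′))

  -- Sentences of T are weakened only to live in the same scope as the
  -- formulas of p, whose free variable acts as a fresh constant.
  ConsistentWith : Pred (Sentence τ) ℓ → Pred (Formula τ 1) ℓ → Set ℓ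
  ConsistentWith T p = Consistent (p ∪ λ ψ → ∃[ θ ] T θ × ψ ≡ weaken θ)

module _ {τ : Signature} where

  ω-Saturated : Structure τ ℓ → Set (lsuc ℓ)
  ω-Saturated {ℓ} A =
    ∀ {k} (c : Vec (Carrier A) k) (p : Pred (Formula (τ ⊕ k) 1) ℓ) →
    ConsistentWith (Th (A ⟪ c ⟫)) p →
    ∃[ x ] (∀ φ → p φ → Sat (A ⟪ c ⟫) φ (x ∷ []))

  HomomorphismLifting : Structure τ ℓ → Set ℓ
  HomomorphismLifting A =
    ∀ {k} (a : Vec (Carrier (A ^ ℕ)) k) (b : Vec (Carrier A) k) →
    (∀ (φ : Sentence (τ ⊕ k)) → PP φ → ((A ^ ℕ) ⟪ a ⟫) ⊨ φ → (A ⟪ b ⟫) ⊨ φ) →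
    ∃[ f ] IsHomomorphism ((A ^ ℕ) ⟪ a ⟫) (A ⟪ b ⟫) f

-- The cardinals κ with 1 ≤ κ ≤ ω.  Arity 0 is excluded: the empty relation is
-- pp-definable by ⊥, but is vacuously not preserved by a nullary operation.
data Arity : Set where
  finite : (n : ℕ) → .{{NonZero n}} → Arity
  ω      : Arity

Index : Arity → Set
Index (finite n) = Fin n
Index ω          = ℕ

Operation : Set ℓ → Set ℓ
Operation X = ∃[ κ ] ((Index κ → X) → X)

Relation : Set ℓ → ℕ → Set (lsuc ℓ)
Relation {ℓ} X m = Pred (Vec X m) ℓ

Preserves : ∀ {I : Set} {X : Set ℓ} → ((I → X) → X) → Relation X m → Set ℓ
Preserves f R = ∀ as → (∀ β → R (as at β)) → R (Vec.map f as)

Inv : ∀ {ℓ′} {X : Set ℓ} → Pred (Operation X) ℓ′ → Pred (Relation X m) (ℓ ⊔ ℓ′)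
Inv F R = ∀ κ f → F (κ , f) → Preserves f R

module _ {τ : Signature} (A : Structure τ ℓ) where

  IsPolymorphism : ∀ κ → ((Index κ → Carrier A) → Carrier A) → Set ℓ
  IsPolymorphism κ = IsHomomorphism (A ^ Index κ) A

  Polω : Pred (Operation (Carrier A)) ℓ
  Polω (κ , f) = IsPolymorphism κ f

  Defines : Formula τ m → Relation (Carrier A) m → Set ℓ
  Defines φ R = ∀ v → R v ⇔ Sat A φ v

  ⟨_⟩fo : Pred (Relation (Carrier A) m) ℓ
  ⟨_⟩fo R = ∃[ φ ] Defines φ R

  ⟨_⟩pp : Pred (Relation (Carrier A) m) ℓ
  ⟨_⟩pp R = ∃[ φ ] PP φ × Defines φ R

{-# OPTIONS --safe #-}
-- Suppose R is defined by φ, preserved by all ω-polymorphisms, and not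
-- pp-definable.  The formulas ψ ∧ ¬ φ with ψ pp and R ⊆ ψ then form a type that
-- is finitely satisfiable, hence realised by some tuple b.  Every pp-formula
-- that fails at b fails at some tuple of R, and there are only countably many
-- of them, so R contains a sequence of tuples such that every pp-formula true
-- along the whole sequence is true at b.  Homomorphism lifting maps this
-- sequence to b, hence b ∈ R: a contradiction.
module Submission where

open import Defs
open import Axiom.ExcludedMiddle using (ExcludedMiddle)
open import Axiom.DoubleNegationElimination using (em⇒dne)
open import Data.Empty using (⊥; ⊥-elim)
open import Data.Empty.Polymorphic as Empty using ()
open import Data.Fin using (zero; suc; toℕ)
open import Data.Fin.Properties using (toℕ-injective)
open import Data.List using (List; []; _∷_; map)
open import Data.List.Relation.Unary.All as All using (All; []; _∷_)
open import Data.List.Relation.Unary.All.Properties using (map⁺)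
open import Data.Nat using (ℕ; zero; suc; _*_)
open import Data.Nat.Properties using (even≢odd; *-cancelˡ-≡; suc-injective)
open import Data.Product using (∃; ∃-syntax; _×_; _,_; proj₁; proj₂)
open import Data.Product.Function.NonDependent.Propositional using (_×-⇔_)
open import Data.Sum using (_⊎_; inj₁; inj₂; [_,_])
open import Data.Sum.Function.Propositional using (_⊎-⇔_)
open import Data.Vec as Vec using (Vec; []; _∷_; lookup; tabulate)
open import Data.Vec.Properties using (lookup-map; tabulate-∘; tabulate∘lookup)
open import Data.Vec.Relation.Binary.Pointwise.Inductive as Pw using (Pointwise; []; _∷_)
open import Function using (_∘_; _⇔_; mk⇔; Equivalence; Injection)
open import Function.Related.TypeIsomorphisms using (→-cong-⇔)
open import Level using (Level)
open import Relation.Binary.PropositionalEquality using (_≡_; refl; cong; cong₂; subst; sym; trans)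
open import Relation.Nullary using (¬_; Dec; yes; no)
open import Relation.Unary using (Pred; _⊆_; _∩_; _≐_)

open Signature
open Structure using (Carrier)
open Equivalence using (to; from)

private variable
  ℓ : Level
  n m k : ℕ
  τ : Signature

-- Satisfaction, substitution and soundness.

∀-cong-⇔ : ∀ {X : Set ℓ} {P Q : X → Set ℓ} → (∀ x → P x ⇔ Q x) → (∀ x → P x) ⇔ (∀ x → Q x)
∀-cong-⇔ h = mk⇔ (λ p x → to (h x) (p x)) (λ q x → from (h x) (q x))

∃-cong-⇔ : ∀ {X : Set ℓ} {P Q : X → Set ℓ} → (∀ x → P x ⇔ Q x) → ∃ P ⇔ ∃ Q
∃-cong-⇔ h = mk⇔ (λ (x , p) → x , to (h x) p) (λ (x , q) → x , from (h x) q)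

module _ (A : Structure τ ℓ) where
  open Structure A using (_≈_)
    renaming (refl to ≈-refl; sym to ≈-sym; trans to ≈-trans; Carrier to X; rel to relᴬ; rel-resp to relᴬ-resp)

  -- The middle type `S` is arbitrary, so that substitutions, homomorphisms and evaluation at a
  -- coordinate are all covered.
  map-map-≈ : ∀ {s} {S : Set s} {T : Set} {f : S → X} {g : T → S} {h : T → X} → (∀ t → f (g t) ≈ h t) →
    ∀ (ts : Vec T k) → Pointwise _≈_ (Vec.map f (Vec.map g ts)) (Vec.map h ts)
  map-map-≈ h []       = []
  map-map-≈ h (t ∷ ts) = h t ∷ map-map-≈ h ts

  rel-cong : ∀ r {xs ys} → Pointwise _≈_ xs ys → relᴬ r xs ⇔ relᴬ r ys
  rel-cong r p = mk⇔ (relᴬ-resp r p) (relᴬ-resp r (Pw.sym ≈-sym p))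

  ≈-cong : ∀ {x x′ y y′} → x ≈ x′ → y ≈ y′ → (x ≈ y) ⇔ (x′ ≈ y′)
  ≈-cong p q = mk⇔ (λ e → ≈-trans (≈-sym p) (≈-trans e q)) (λ e → ≈-trans p (≈-trans e (≈-sym q)))

  value-subᵗ : ∀ {w : Vec X m} {v : Vec X n} {σ : Subst {τ = τ} n m} →
    (∀ i → value A w (σ i) ≈ lookup v i) → ∀ t → value A w (subᵗ σ t) ≈ value A v t
  value-subᵗ h (var i) = h i
  value-subᵗ h (con c) = ≈-refl

  value-weaken : ∀ {x} {v : Vec X n} t → value A (x ∷ v) (subᵗ (var ∘ suc) t) ≈ value A v t
  value-weaken (var i) = ≈-refl
  value-weaken (con c) = ≈-refl

  value-lift : ∀ {x} {w : Vec X m} {v : Vec X n} {σ : Subst {τ = τ} n m} →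
    (∀ i → value A w (σ i) ≈ lookup v i) → ∀ i → value A (x ∷ w) (lift σ i) ≈ lookup (x ∷ v) i
  value-lift h zero    = ≈-refl
  value-lift {σ = σ} h (suc i) = ≈-trans (value-weaken (σ i)) (h i)

  -- Relating the assignments only up to `_≈_` lets this one induction yield weakening,
  -- instantiation and invariance under `_≈_`.
  Sat-sub : ∀ φ {w : Vec X m} {v : Vec X n} {σ : Subst n m} →
    (∀ i → value A w (σ i) ≈ lookup v i) → Sat A (sub σ φ) w ⇔ Sat A φ v
  Sat-sub ⊥′         h = mk⇔ (λ x → x) (λ x → x)
  Sat-sub (rel r ts) h = rel-cong r (map-map-≈ (value-subᵗ h) ts)
  Sat-sub (s == t)   h = ≈-cong (value-subᵗ h s) (value-subᵗ h t)
  Sat-sub (φ ∧ ψ)    h = Sat-sub φ h ×-⇔ Sat-sub ψ h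
  Sat-sub (φ ∨ ψ)    h = Sat-sub φ h ⊎-⇔ Sat-sub ψ h
  Sat-sub (φ ⇒ ψ)    h = →-cong-⇔ (Sat-sub φ h) (Sat-sub ψ h)
  Sat-sub (∀′ φ)     h = ∀-cong-⇔ λ _ → Sat-sub φ (value-lift h)
  Sat-sub (∃′ φ)     h = ∃-cong-⇔ λ _ → Sat-sub φ (value-lift h)

  Sat-resp : ∀ φ {v w : Vec X n} → (∀ i → lookup v i ≈ lookup w i) → Sat A φ v → Sat A φ w
  -- With the identity substitution, `sub var φ` at `v` is equivalent both to `φ` at `v` and to `φ`
  -- at `w`.
  Sat-resp φ {v} h p = to (Sat-sub φ h) (from (Sat-sub φ {w = v} {σ = var} λ _ → ≈-refl) p)

  Sat-weaken : ∀ φ {x} {v : Vec X n} → Sat A (weaken φ) (x ∷ v) ⇔ Sat A φ v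
  Sat-weaken φ = Sat-sub φ λ _ → ≈-refl

  Sat-instantiate : ∀ φ {t} {x} {v : Vec X n} → value A v t ≈ x → Sat A (φ [ t ]) v ⇔ Sat A φ (x ∷ v)
  Sat-instantiate φ e = Sat-sub φ λ { zero → e ; (suc i) → ≈-refl }

  All-weaken : ∀ {x} {v : Vec X n} {Γ} → All (λ φ → Sat A φ v) Γ →
    All (λ φ → Sat A φ (x ∷ v)) (map weaken Γ)
  All-weaken = map⁺ ∘ All.map (λ {φ} → from (Sat-weaken φ))

  -- Turns a common solution of finitely many formulas into the syntactic consistency that
  -- saturation asks for. Excluded middle enters through `raa`.
  sound : ExcludedMiddle ℓ → ∀ {Γ : List (Formula τ n)} {φ} → Γ ⊢ φ →
    ∀ v → All (λ ψ → Sat A ψ v) Γ → Sat A φ v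
  sound em (ax i)          v γ = All.lookup γ i
  sound em (raa d)         v γ =
    em⇒dne em λ ¬p → Empty.⊥-elim (sound em d v ((λ p → ⊥-elim (¬p p)) ∷ γ))
  sound em (∧-intro d e)   v γ = sound em d v γ , sound em e v γ
  sound em (∧-elimˡ d)     v γ = proj₁ (sound em d v γ)
  sound em (∧-elimʳ d)     v γ = proj₂ (sound em d v γ)
  sound em (∨-introˡ d)    v γ = inj₁ (sound em d v γ)
  sound em (∨-introʳ d)    v γ = inj₂ (sound em d v γ)
  sound em (∨-elim d e f)  v γ =
    [ (λ p → sound em e v (p ∷ γ)) , (λ p → sound em f v (p ∷ γ)) ] (sound em d v γ)
  sound em (⇒-intro d)     v γ = λ p → sound em d v (p ∷ γ)
  sound em (⇒-elim d e)    v γ = sound em d v γ (sound em e v γ)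
  sound em (∀-intro d)     v γ = λ x → sound em d (x ∷ v) (All-weaken γ)
  sound em (∀-elim {φ} d t) v γ = from (Sat-instantiate φ ≈-refl) (sound em d v γ (value A v t))
  sound em (∃-intro {φ} t d) v γ = value A v t , to (Sat-instantiate φ ≈-refl) (sound em d v γ)
  sound em (∃-elim {ψ = ψ} d e) v γ with x , p ← sound em d v γ =
    to (Sat-weaken ψ) (sound em e (x ∷ v) (p ∷ All-weaken γ))
  sound em (==-refl t)     v γ = ≈-refl
  sound em (==-subst φ d e) v γ =
    from (Sat-instantiate φ (≈-sym (sound em d v γ))) (to (Sat-instantiate φ ≈-refl) (sound em e v γ))

-- Exchanging variables and constants.

-- By eta, `τ` and `τ ⊕ k` both have this form, so one translation moves parameters in either
-- direction.
withCon : Signature → Set → Signature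
withCon τ C = record { Rel = Rel τ ; arity = arity τ ; Con = C }

interpret : ∀ {C} (A : Structure τ ℓ) → (C → Carrier A) → Structure (withCon τ C) ℓ
interpret A c = record
  { domain   = A.domain
  ; nonempty = A.nonempty
  ; rel      = A.rel
  ; rel-resp = A.rel-resp
  ; con      = c
  } where module A = Structure A

module Translation (τ : Signature) {C D : Set} where

  -- Constants may turn into variables, so `σ` acts on whole terms and the images of constants are
  -- weakened too.
  liftᵗ : (Term (withCon τ C) n → Term (withCon τ D) m) →
    Term (withCon τ C) (suc n) → Term (withCon τ D) (suc m)
  liftᵗ σ (var zero)    = var zero
  liftᵗ σ (var (suc i)) = subᵗ (var ∘ suc) (σ (var i))
  liftᵗ σ (con c)       = subᵗ (var ∘ suc) (σ (con c))

  translate : (Term (withCon τ C) n → Term (withCon τ D) m) →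
    Formula (withCon τ C) n → Formula (withCon τ D) m
  translate σ ⊥′         = ⊥′
  translate σ (rel r ts) = rel r (Vec.map σ ts)
  translate σ (s == t)   = σ s == σ t
  translate σ (φ ∧ ψ)    = translate σ φ ∧ translate σ ψ
  translate σ (φ ∨ ψ)    = translate σ φ ∨ translate σ ψ
  translate σ (φ ⇒ ψ)    = translate σ φ ⇒ translate σ ψ
  translate σ (∀′ φ)     = ∀′ (translate (liftᵗ σ) φ)
  translate σ (∃′ φ)     = ∃′ (translate (liftᵗ σ) φ)

  translate-PP : ∀ {σ : Term (withCon τ C) n → Term (withCon τ D) m} {φ} → PP φ → PP (translate σ φ)
  translate-PP ⊥′         = ⊥′
  translate-PP (rel r ts) = rel r _
  translate-PP (s == t)   = _ == _
  translate-PP (p ∧ q)    = translate-PP p ∧ translate-PP q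
  translate-PP (∃′ p)     = ∃′ (translate-PP p)

  module _ (A : Structure τ ℓ) {c : C → Carrier A} {d : D → Carrier A} where
    open Structure A using (_≈_) renaming (refl to ≈-refl; trans to ≈-trans)
    private
      AC = interpret A c
      AD = interpret A d

    value-liftᵗ : ∀ {x v w} {σ : Term (withCon τ C) n → Term (withCon τ D) m} →
      (∀ t → value AD w (σ t) ≈ value AC v t) →
      ∀ t → value AD (x ∷ w) (liftᵗ σ t) ≈ value AC (x ∷ v) t
    value-liftᵗ h (var zero)            = ≈-refl
    value-liftᵗ {σ = σ} h (var (suc i)) = ≈-trans (value-weaken AD (σ (var i))) (h (var i))
    value-liftᵗ {σ = σ} h (con c)       = ≈-trans (value-weaken AD (σ (con c))) (h (con c))

    Sat-translate : ∀ φ {v w} {σ : Term (withCon τ C) n → Term (withCon τ D) m} →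
      (∀ t → value AD w (σ t) ≈ value AC v t) →
      Sat AD (translate σ φ) w ⇔ Sat AC φ v
    Sat-translate ⊥′         h = mk⇔ (λ x → x) (λ x → x)
    Sat-translate (rel r ts) h = rel-cong A r (map-map-≈ A h ts)
    Sat-translate (s == t)   h = ≈-cong A (h s) (h t)
    Sat-translate (φ ∧ ψ)    h = Sat-translate φ h ×-⇔ Sat-translate ψ h
    Sat-translate (φ ∨ ψ)    h = Sat-translate φ h ⊎-⇔ Sat-translate ψ h
    Sat-translate (φ ⇒ ψ)    h = →-cong-⇔ (Sat-translate φ h) (Sat-translate ψ h)
    Sat-translate (∀′ φ)     h = ∀-cong-⇔ λ _ → Sat-translate φ (value-liftᵗ h)
    Sat-translate (∃′ φ)     h = ∃-cong-⇔ λ _ → Sat-translate φ (value-liftᵗ h)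

parametrizeᵗ : Term τ (suc k) → Term (τ ⊕ k) 1
parametrizeᵗ (var zero)    = var zero
parametrizeᵗ (var (suc i)) = con (inj₂ i)
parametrizeᵗ (con c)       = con (inj₁ c)

parametrize : Formula τ (suc k) → Formula (τ ⊕ k) 1
parametrize {τ} = Translation.translate τ parametrizeᵗ

abstractᵗ : Term (τ ⊕ k) 0 → Term τ k
abstractᵗ (con (inj₁ c)) = con c
abstractᵗ (con (inj₂ i)) = var i

-- Homomorphism lifting speaks of sentences about named elements; as formulas, these can be tested
-- on every tuple of `R`.
abstractParameters : Sentence (τ ⊕ k) → Formula τ k
abstractParameters {τ} = Translation.translate τ abstractᵗ

module _ (A : Structure τ ℓ) where
  open Structure A using () renaming (refl to ≈-refl)

  Sat-parametrize : ∀ φ {x} {v : Vec (Carrier A) k} →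
    Sat (A ⟪ v ⟫) (parametrize φ) (x ∷ []) ⇔ Sat A φ (x ∷ v)
  Sat-parametrize φ =
    Translation.Sat-translate τ A φ λ { (var zero) → ≈-refl ; (var (suc i)) → ≈-refl ; (con c) → ≈-refl }

  Sat-abstract : ∀ φ {v : Vec (Carrier A) k} → Sat A (abstractParameters φ) v ⇔ (A ⟪ v ⟫) ⊨ φ
  Sat-abstract φ = Translation.Sat-translate τ A φ λ { (con (inj₁ c)) → ≈-refl ; (con (inj₂ i)) → ≈-refl }

  -- Realising types in several variables.

  -- Finite satisfiability in a form that survives quantification: a solution of one lower bound,
  -- itself in `Φ`, solves finitely many members jointly.
  record Directed (Φ : Pred (Formula τ n) ℓ) : Set ℓ where
    field
      inhabited   : ∃ Φ
      lower-bound : ∀ φ ψ → Φ φ → Φ ψ →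
        ∃[ χ ] Φ χ × (∀ v → Sat A χ v → Sat A φ v × Sat A ψ v)
      satisfiable : ∀ φ → Φ φ → ∃ (Sat A φ)

    finite-lower-bound : ∀ {Γ} → All Φ Γ → ∃[ χ ] Φ χ × (∀ v → Sat A χ v → All (λ φ → Sat A φ v) Γ)
    finite-lower-bound [] = let χ , Φχ = inhabited in χ , Φχ , λ _ _ → []
    finite-lower-bound (_∷_ {φ} Φφ Φs) =
      let χ , Φχ , χ⇒Γ = finite-lower-bound Φs
          θ , Φθ , θ⇒  = lower-bound φ χ Φφ Φχ
      in θ , Φθ , λ v p → proj₁ (θ⇒ v p) ∷ χ⇒Γ v (proj₂ (θ⇒ v p))

  ∃-closure : Pred (Formula τ (suc n)) ℓ → Pred (Formula τ n) ℓ
  ∃-closure Φ ψ = ∃[ φ ] Φ φ × ψ ≡ ∃′ φ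

  ∃-closure-Directed : ∀ {Φ : Pred (Formula τ (suc n)) ℓ} → Directed Φ → Directed (∃-closure Φ)
  ∃-closure-Directed D = record
    { inhabited   = let φ , Φφ = inhabited in ∃′ φ , φ , Φφ , refl
    ; lower-bound = λ { _ _ (φ , Φφ , refl) (ψ , Φψ , refl) →
        let χ , Φχ , χ⇒ = lower-bound φ ψ Φφ Φψ in
        ∃′ χ , (χ , Φχ , refl) ,
        λ { v (x , p) → (x , proj₁ (χ⇒ (x ∷ v) p)) , (x , proj₂ (χ⇒ (x ∷ v) p)) } }
    ; satisfiable = λ { _ (φ , Φφ , refl) → let v , p = satisfiable φ Φφ in ∃-witness φ v p }
    }
    where
    open Directed D
    ∃-witness : ∀ φ v → Sat A φ v → ∃ (Sat A (∃′ φ))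
    ∃-witness φ (x ∷ v) p = v , x , p

  -- Realising the ∃-closure first makes it consistent to choose the value of
  -- variable zero last, with all other values as parameters.
  realise : ExcludedMiddle ℓ → ω-Saturated A →
    ∀ {n} {Φ : Pred (Formula τ n) ℓ} → Directed Φ → ∃[ v ] (∀ {φ} → Φ φ → Sat A φ v)
  realise em sat {zero} D = [] , λ {φ} Φφ → only-[] φ (satisfiable φ Φφ)
    where
    open Directed D
    only-[] : ∀ φ → ∃ (Sat A φ) → Sat A φ []
    only-[] φ ([] , p) = p
  realise em sat {suc n} {Φ} D =
    let x , realises = sat v type consistent
    in x ∷ v , λ {φ} Φφ → to (Sat-parametrize φ) (realises _ (φ , Φφ , refl))
    where
    open Directed D
    IH = realise em sat (∃-closure-Directed D)
    v = proj₁ IH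

    type : Pred (Formula (τ ⊕ n) 1) ℓ
    type ψ = ∃[ φ ] Φ φ × ψ ≡ parametrize φ

    Hyp = λ ψ → type ψ ⊎ ∃[ θ ] Th (A ⟪ v ⟫) θ × ψ ≡ weaken θ

    -- The sentences of the theory hold at `v` already, so only the members of `type` restrict `x`.
    premises : ∀ {Γ} → All Hyp Γ → ∃[ Δ ] All Φ Δ ×
      (∀ x → All (λ φ → Sat A φ (x ∷ v)) Δ → All (λ ψ → Sat (A ⟪ v ⟫) ψ (x ∷ [])) Γ)
    premises [] = [] , [] , λ _ _ → []
    premises (h ∷ hs) with premises hs | h
    ... | Δ , ΦΔ , Δ⇒ | inj₁ (φ , Φφ , refl) =
      φ ∷ Δ , Φφ ∷ ΦΔ , λ { x (p ∷ ps) → from (Sat-parametrize φ) p ∷ Δ⇒ x ps }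
    ... | Δ , ΦΔ , Δ⇒ | inj₂ (θ , p , refl) =
      Δ , ΦΔ , λ x ps → from (Sat-weaken (A ⟪ v ⟫) θ) p ∷ Δ⇒ x ps

    -- Finitely many members of the type follow from one `χ` in `Φ`. Since `v` satisfies `∃′ χ`, a
    -- witness `x` makes all premises true, and soundness excludes a proof of `⊥′`.
    consistent : ConsistentWith (Th (A ⟪ v ⟫)) type
    consistent (Γ , hs , d) =
      let Δ , ΦΔ , Δ⇒  = premises hs
          χ , Φχ , χ⇒Δ = finite-lower-bound ΦΔ
          x , p        = proj₂ IH (χ , Φχ , refl)
      in Empty.⊥-elim (sound (A ⟪ v ⟫) em d (x ∷ []) (Δ⇒ x (χ⇒Δ (x ∷ v) p)))

-- Countability of formulas.

-- The number 2^a * (2b + 1).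
pair : ℕ → ℕ → ℕ
pair zero    b = suc (2 * b)
pair (suc a) b = 2 * pair a b

pair-injective : ∀ a b c d → pair a b ≡ pair c d → a ≡ c × b ≡ d
pair-injective zero    b zero    d e = refl , *-cancelˡ-≡ b d 2 (suc-injective e)
pair-injective zero    b (suc c) d e = ⊥-elim (even≢odd (pair c d) b (sym e))
pair-injective (suc a) b zero    d e = ⊥-elim (even≢odd (pair a b) d e)
pair-injective (suc a) b (suc c) d e =
  let p , q = pair-injective a b c d (*-cancelˡ-≡ (pair a b) (pair c d) 2 e) in cong suc p , q

module Coding (τ : Signature) (countable : Countable τ) where
  open Injection (proj₁ countable) using () renaming (to to code-rel; injective to code-rel-injective)
  open Injection (proj₂ countable) using () renaming (to to code-con; injective to code-con-injective)

  codeᵗ : Term τ n → ℕ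
  codeᵗ (var i) = pair 0 (toℕ i)
  codeᵗ (con c) = pair 1 (code-con c)

  codeᵗ-injective : ∀ (s t : Term τ n) → codeᵗ s ≡ codeᵗ t → s ≡ t
  codeᵗ-injective (var i) (var j) e = cong var (toℕ-injective (proj₂ (pair-injective 0 _ 0 _ e)))
  codeᵗ-injective (con c) (con d) e = cong con (code-con-injective (proj₂ (pair-injective 1 _ 1 _ e)))
  codeᵗ-injective (var i) (con d) e with () ← proj₁ (pair-injective 0 (toℕ i) 1 (code-con d) e)
  codeᵗ-injective (con c) (var j) e with () ← proj₁ (pair-injective 1 (code-con c) 0 (toℕ j) e)

  codeᵗˢ : Vec (Term τ n) k → ℕ
  codeᵗˢ []       = 0
  codeᵗˢ (t ∷ ts) = pair (codeᵗ t) (codeᵗˢ ts)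

  codeᵗˢ-injective : ∀ (ss ts : Vec (Term τ n) k) → codeᵗˢ ss ≡ codeᵗˢ ts → ss ≡ ts
  codeᵗˢ-injective []       []       e = refl
  codeᵗˢ-injective (s ∷ ss) (t ∷ ts) e =
    let p , q = pair-injective (codeᵗ s) _ (codeᵗ t) _ e
    in cong₂ _∷_ (codeᵗ-injective s t p) (codeᵗˢ-injective ss ts q)

  tag : Formula τ n → ℕ
  tag ⊥′        = 0
  tag (rel _ _) = 1
  tag (_ == _)  = 2
  tag (_ ∧ _)   = 3
  tag (_ ∨ _)   = 4
  tag (_ ⇒ _)   = 5
  tag (∀′ _)    = 6
  tag (∃′ _)    = 7

  mutual
    code : Formula τ n → ℕ
    code φ = pair (tag φ) (body φ)

    body : Formula τ n → ℕ
    body ⊥′         = 0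
    body (rel r ts) = pair (code-rel r) (codeᵗˢ ts)
    body (s == t)   = pair (codeᵗ s) (codeᵗ t)
    body (φ ∧ ψ)    = pair (code φ) (code ψ)
    body (φ ∨ ψ)    = pair (code φ) (code ψ)
    body (φ ⇒ ψ)    = pair (code φ) (code ψ)
    body (∀′ φ)     = code φ
    body (∃′ φ)     = code φ

  mutual
    code-injective : ∀ (φ ψ : Formula τ n) → code φ ≡ code ψ → φ ≡ ψ
    code-injective φ ψ e =
      let p , q = pair-injective (tag φ) (body φ) (tag ψ) (body ψ) e in body-injective φ ψ p q

    -- Matching the equation of tags with `refl` rules out distinct head constructors, which leaves
    -- the diagonal cases.
    body-injective : ∀ (φ ψ : Formula τ n) → tag φ ≡ tag ψ → body φ ≡ body ψ → φ ≡ ψ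
    body-injective ⊥′         ⊥′           refl e = refl
    body-injective (rel r ss) (rel r′ ts)  refl e
      with p , q ← pair-injective (code-rel r) (codeᵗˢ ss) (code-rel r′) (codeᵗˢ ts) e
      -- Identifying the relation symbols first gives both term vectors the same length, as
      -- `codeᵗˢ-injective` requires.
      with refl ← code-rel-injective p = cong (rel r) (codeᵗˢ-injective ss ts q)
    body-injective (s == t)   (s′ == t′)   refl e =
      let p , q = pair-injective (codeᵗ s) _ (codeᵗ s′) _ e
      in cong₂ _==_ (codeᵗ-injective s s′ p) (codeᵗ-injective t t′ q)
    body-injective (φ ∧ ψ)    (φ′ ∧ ψ′)    refl e =
      let p , q = pair-injective (code φ) _ (code φ′) _ e
      in cong₂ _∧_ (code-injective φ φ′ p) (code-injective ψ ψ′ q)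
    body-injective (φ ∨ ψ)    (φ′ ∨ ψ′)    refl e =
      let p , q = pair-injective (code φ) _ (code φ′) _ e
      in cong₂ _∨_ (code-injective φ φ′ p) (code-injective ψ ψ′ q)
    body-injective (φ ⇒ ψ)    (φ′ ⇒ ψ′)    refl e =
      let p , q = pair-injective (code φ) _ (code φ′) _ e
      in cong₂ _⇒_ (code-injective φ φ′ p) (code-injective ψ ψ′ q)
    body-injective (∀′ φ)     (∀′ ψ)       refl e = cong ∀′ (code-injective φ ψ e)
    body-injective (∃′ φ)     (∃′ ψ)       refl e = cong ∃′ (code-injective φ ψ e)

-- Primitive positive formulas under homomorphisms and powers.

module _ {A B : Structure τ ℓ} {f} (hom : IsHomomorphism A B f) where
  private module B = Structure B
  open IsHomomorphism hom renaming (cong to f-cong)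

  value-hom : ∀ (v : Vec (Carrier A) n) t → f (value A v t) B.≈ value B (Vec.map f v) t
  value-hom v (var i) = B.reflexive (sym (lookup-map i f v))
  value-hom v (con c) = con-pres c

  hom-preserves-PP : ∀ {φ} → PP φ → ∀ {v : Vec (Carrier A) n} → Sat A φ v → Sat B φ (Vec.map f v)
  hom-preserves-PP (rel r ts) {v} p = B.rel-resp r (map-map-≈ B (value-hom v) ts) (rel-pres r p)
  hom-preserves-PP (s == t)   {v} e =
    B.trans (B.sym (value-hom v s)) (B.trans (f-cong e) (value-hom v t))
  hom-preserves-PP (p ∧ q) (a , b) = hom-preserves-PP p a , hom-preserves-PP q b
  hom-preserves-PP (∃′ p)  (x , a) = f x , hom-preserves-PP p a

module _ (A : Structure τ ℓ) where
  private module A = Structure A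

  value-power : ∀ {I} (v : Vec (I → Carrier A) n) i t → value (A ^ I) v t i ≡ value A (v at i) t
  value-power v i (var j) = sym (lookup-map j _ v)
  value-power v i (con c) = refl

  -- The coordinate witnesses ⊥ in the power, which would otherwise be false
  -- there while vacuously true in every coordinate.
  power-PP : ∀ {I φ} → I → PP φ → ∀ {v : Vec (I → Carrier A) n} →
    (∀ i → Sat A φ (v at i)) → Sat (A ^ I) φ v
  power-PP i₀ ⊥′         h = h i₀
  power-PP i₀ (rel r ts) {v} h i = A.rel-resp r
    (Pw.sym A.sym (map-map-≈ A (A.reflexive ∘ value-power v i) ts)) (h i)
  power-PP i₀ (s == t)   {v} h i = A.trans (A.reflexive (value-power v i s))
    (A.trans (h i) (A.sym (A.reflexive (value-power v i t))))
  power-PP i₀ (p ∧ q) h = power-PP i₀ p (proj₁ ∘ h) , power-PP i₀ q (proj₂ ∘ h)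
  power-PP i₀ (∃′ p)  h = proj₁ ∘ h , power-PP i₀ p (proj₂ ∘ h)

  -- With `hom-preserves-PP`, this brings pp-sentences true in the power down to each coordinate.
  projection : ∀ {I} (a : Vec (I → Carrier A) k) i →
    IsHomomorphism ((A ^ I) ⟪ a ⟫) (A ⟪ a at i ⟫) (λ x → x i)
  projection a i = record
    { cong     = λ e → e i
    ; rel-pres = λ r h → h i
    ; con-pres = λ { (inj₁ c) → A.refl ; (inj₂ j) → A.reflexive (sym (lookup-map j _ a)) }
    }

  -- A pp-formula true in every coordinate is true in the power, and the polymorphism carries it
  -- back to `A`.
  pp⇒Inv : ∀ {R : Relation (Carrier A) m} → ⟨ A ⟩pp R → Inv (Polω A) R
  pp⇒Inv (φ , pp , def) κ f hom as h =
    from (def _) (hom-preserves-PP hom pp (power-PP (index κ) pp (λ β → to (def _) (h β))))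
    where
    -- The coordinate that `power-PP` asks for; it exists because arity zero is excluded.
    index : ∀ κ → Index κ
    index (finite (suc n)) = zero
    index ω                = 0

  -- Mapping a sequence in `R` to a given tuple.

  at-transpose : ∀ {I : Set} (s : I → Vec (Carrier A) k) i →
    tabulate (λ j i → lookup (s i) j) at i ≡ s i
  at-transpose s i = trans (sym (tabulate-∘ (λ x → x i) _)) (tabulate∘lookup (s i))

  module _ (em : ExcludedMiddle ℓ) (countable : Countable τ) where
    open Coding τ countable

    -- Entry i is a tuple of R violating the formula with code i, if there is one.
    refuting-sequence : (R : Relation (Carrier A) m) → ∃ R → ∃[ s ] (∀ i → R (s i)) ×
      (∀ φ → (∃[ v ] R v × ¬ Sat A φ v) → ∃[ i ] ¬ Sat A φ (s i))
    refuting-sequence R (v₀ , Rv₀) = s , proj₂ ∘ entry , refutes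
      where
      Refuted : ℕ → Set _
      Refuted i = ∃[ φ ] code φ ≡ i × ∃[ v ] R v × ¬ Sat A φ v

      choose : ∀ {i} → Dec (Refuted i) → ∃ R
      choose (yes (_ , _ , v , Rv , _)) = v , Rv
      -- The default keeps the sequence inside `R` at positions where nothing is refuted.
      choose (no _)                     = v₀ , Rv₀

      entry : ℕ → ∃ R
      entry i = choose (em {Refuted i})

      s = proj₁ ∘ entry

      -- Injectivity of `code` forces the formula found at `code φ` to be `φ` itself. The decision
      -- is a variable so that it can be split on.
      chosen : ∀ φ → (∃[ v ] R v × ¬ Sat A φ v) → (d : Dec (Refuted (code φ))) →
        ¬ Sat A φ (proj₁ (choose d))
      chosen φ r (yes (ψ , e , v , Rv , ¬p)) =
        subst (λ χ → ¬ Sat A χ v) (code-injective ψ φ e) ¬p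
      chosen φ r (no ¬r) = ⊥-elim (¬r (φ , refl , r))

      refutes : ∀ φ → (∃[ v ] R v × ¬ Sat A φ v) → ∃[ i ] ¬ Sat A φ (s i)
      refutes φ r = code φ , chosen φ r em

    lift-sequence : HomomorphismLifting A → ∀ {R : Relation (Carrier A) m} → ∃ R → ∀ b →
      (∀ ψ → PP ψ → R ⊆ Sat A ψ → Sat A ψ b) →
      ∃[ f ] ∃[ a ] IsPolymorphism A ω f × (∀ i → R (a at i)) ×
        (∀ j → lookup (Vec.map f a) j A.≈ lookup b j)
    lift-sequence lifting {R} ∃R b below =
      f , a , polymorphism , (λ i → subst R (sym (at-transpose s i)) (Rs i)) ,
      -- The added constant `inj₂ j` names entry `j` of `a` in the power and of `b` in `A`, so
      -- preserving it means that `f` sends one to the other.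
      λ j → A.trans (A.reflexive (lookup-map j f a)) (con-pres (inj₂ j))
      where
      sequence = refuting-sequence R ∃R
      s = proj₁ sequence
      Rs = proj₁ (proj₂ sequence)
      a = tabulate λ j i → lookup (s i) j

      -- A pp-sentence true in the power holds at every entry of the sequence. By the choice of the
      -- entries no tuple of `R` refutes it, so `below` gives it at `b`.
      transfer : ∀ φ → PP φ → ((A ^ ℕ) ⟪ a ⟫) ⊨ φ → (A ⟪ b ⟫) ⊨ φ
      transfer φ pp p = to (Sat-abstract A φ) (below (abstractParameters φ) (Translation.translate-PP τ pp)
        λ {v} Rv → em⇒dne em λ ¬q →
          let i , ¬p = proj₂ (proj₂ sequence) (abstractParameters φ) (v , Rv , ¬q)
          in ¬p (subst (Sat A (abstractParameters φ)) (at-transpose s i)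
               (from (Sat-abstract A φ) (hom-preserves-PP (projection a i) pp p))))

      lifted = lifting a b transfer
      f = proj₁ lifted
      open IsHomomorphism (proj₂ lifted) renaming (cong to f-cong)

      polymorphism : IsPolymorphism A ω f
      polymorphism = record { cong = f-cong ; rel-pres = rel-pres ; con-pres = con-pres ∘ inj₁ }

    -- From preservation to pp-definability.

    preserved⇒pp : ω-Saturated A → HomomorphismLifting A →
      ∀ {R : Relation (Carrier A) m} → ⟨ A ⟩fo R →
      (∀ f → IsPolymorphism A ω f → Preserves f R) → ⟨ A ⟩pp R
    preserved⇒pp saturated lifting {R} (φ , def) preserved = em⇒dne em contradict
      where
      module _ (¬pp : ¬ ⟨ A ⟩pp R) where
        -- An empty `R` would be defined by `⊥′`.
        ∃R : ∃ R
        ∃R = em⇒dne em λ ¬∃R →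
          ¬pp (⊥′ , ⊥′ , λ v → mk⇔ (λ Rv → ⊥-elim (¬∃R (v , Rv))) (λ ()))

        -- Every member carries the negation of `φ`, so conjoining the pp-parts alone gives lower
        -- bounds within `Φ`.
        Φ : Pred (Formula τ _) ℓ
        Φ χ = ∃[ ψ ] PP ψ × R ⊆ Sat A ψ × χ ≡ (ψ ∧ (φ ⇒ ⊥′))

        ⊤′ : Formula τ _
        ⊤′ = ∃′ (var zero == var zero)

        directed : Directed A Φ
        directed = record
          { inhabited   = _ , ⊤′ , ∃′ (_ == _) , (λ _ → A.nonempty , A.refl) , refl
          ; lower-bound = λ { _ _ (ψ₁ , pp₁ , R⊆₁ , refl) (ψ₂ , pp₂ , R⊆₂ , refl) →
              _ , (ψ₁ ∧ ψ₂ , pp₁ ∧ pp₂ , (λ Rv → R⊆₁ Rv , R⊆₂ Rv) , refl) ,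
              λ { v ((p₁ , p₂) , ¬q) → (p₁ , ¬q) , (p₂ , ¬q) } }
          -- If `ψ` and the negation of `φ` had no common solution, `ψ` would imply `φ` and thus
          -- define `R`.
          ; satisfiable = λ { _ (ψ , pp , R⊆ , refl) → em⇒dne em λ none →
              ¬pp (ψ , pp , λ v → mk⇔ R⊆ λ p → em⇒dne em λ ¬Rv →
                none (v , p , λ q → ⊥-elim (¬Rv (from (def v) q)))) }
          }

        contradict : ⊥
        contradict =
          let b , realises = realise A em saturated directed
              f , a , hom , Ra , fa≈b = lift-sequence lifting ∃R b
                (λ ψ pp R⊆ → proj₁ (realises (ψ , pp , R⊆ , refl)))
              -- The image of `a` lies in `R` but equals `b` only up to `_≈_`; satisfaction of `φ`
              -- respects this.
              φb = Sat-resp A φ fa≈b (to (def _) (preserved f hom a Ra))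
          in Empty.⊥-elim (proj₂ (realises (proj₂ (Directed.inhabited directed))) φb)

theorem4 : ∀ {ℓ} → ExcludedMiddle ℓ →
    ∀ {τ} → Countable τ → (A : Structure τ ℓ) →
    ω-Saturated A → HomomorphismLifting A →
    ∀ m →
    (∀ (R : Relation (Structure.Carrier A) m) → ⟨ A ⟩fo R →
    ((∀ f → IsPolymorphism A ω f → Preserves f R) ⇔ ⟨ A ⟩pp R))
    × ((Inv (Polω A) ∩ ⟨ A ⟩fo) ≐ ⟨_⟩pp A {m})
theorem4 em countable A saturated lifting m =
    (λ R fo → mk⇔ (pp fo) (λ ppR → pp⇒Inv A ppR ω))
  , (λ (inv , fo) → pp fo (inv ω))
  , (λ ppR@(φ , _ , def) → pp⇒Inv A ppR , φ , def)
  where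
  pp : ∀ {R : Relation (Carrier A) m} → ⟨ A ⟩fo R →
    (∀ f → IsPolymorphism A ω f → Preserves f R) → ⟨ A ⟩pp R
  pp = preserved⇒pp A em countable saturated lifting
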